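{- Let $G$ be a finite simple graph that is $(P_3\cup P_2,K_4)$-free and also free of the co-domino and the co-A. Let $D_1=\{x\in V(G): \omega(G-N(x))\le 2\}$ and $D_2=V(G)\setminus D_1$. If $G[D_2]$ is not isomorphic to an induced subgraph of $K_3$, then $\chi(G)\le 7$.
   Context: $P_n$ is the path on $n$ vertices, $K_n$ the complete graph on $n$ vertices, $\cup$ disjoint union; "free" refers to induced subgraphs. $N(x)$ is the open neighborhood of $x$ and $G-N(x)$ the subgraph induced by $V(G)\setminus N(x)$; $\omega$ is the clique number and $\chi$ the chromatic number. Let $C=u_1v_1v_2v_3u_3u_2$ be a $6$-cycle (edges $u_1v_1, v_1v_2, v_2v_3, v_3u_3, u_3u_2, u_2u_1$). The co-domino is obtained from $C$ by adding edges $v_1v_3$ and $u_1u_3$; the co-A is obtained from $C$ by adding edges $v_1v_3$, $u_1u_3$ and $u_1v_3$. -}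

module Defs where

open import Data.Bool.Base using (if_then_else_)
open import Data.Fin.Base using (Fin; zero; suc; toℕ; splitAt; finToFun; funToFin)
open import Data.Fin.Patterns using (0F; 1F; 2F; 3F; 4F; 5F)
open import Data.Fin.Properties as Fin using (any?; all?; finToFun-funToFin; suc-injective)
open import Data.Fin.Subset using (Subset; inside; outside; _∈_; ∁; ∣_∣; ⊥)
open import Data.Fin.Subset.Properties using (anySubset?; _∈?_; ∉⊥; ∣⊥∣≡0; ∣p∣≤n)
open import Data.List.Base using (List; []; _∷_; _++_)
open import Data.List.Membership.Propositional using () renaming (_∈_ to _∈ˡ_)
import Data.List.Membership.DecPropositional as DecMembership
open import Data.Nat.Base as ℕ using (ℕ; zero; suc; _≤_; z≤n; s≤s)
open import Data.Nat.Properties as ℕ using (_≤?_; m≤n⇒m<n∨m≡n; 1+n≢n)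
open import Data.Product.Base using (Σ; ∃; _×_; _,_)
open import Data.Product.Properties using (≡-dec)
open import Data.Sum.Base using (_⊎_; inj₁; inj₂; swap)
open import Data.Sum.Relation.Binary.Pointwise
  using (Pointwise; ⊎-symmetric; ⊎-decidable; ⊎-irreflexive; ⊎-refl)
open import Data.Vec.Base using ([]; _∷_; tabulate)
open import Function.Base using (_∘_)
open import Function.Bundles using (_↔_; _⇔_; module Inverse)
open import Level using (0ℓ)
open import Relation.Binary.Core using (Rel)
open import Relation.Binary.Definitions using (Decidable; Symmetric; Irreflexive)
open import Relation.Binary.PropositionalEquality
  using (_≡_; _≢_; refl; sym; trans; cong)
open import Relation.Nullary.Decidable
  using (yes; no; does; map′; _×-dec_; _⊎-dec_; _→-dec_; ¬?)
open import Relation.Nullary.Negation using (¬_; contradiction)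
open import Relation.Unary using (Pred) renaming (Decidable to Decidable₁)

private
  variable
    m n : ℕ

record Graph (n : ℕ) : Set₁ where
  infix 4 _~_ _~?_
  field
    _~_      : Rel (Fin n) 0ℓ
    ~-sym    : Symmetric _~_
    ~-irrefl : Irreflexive _≡_ _~_
    _~?_     : Decidable _~_

open Graph

infix 4 _≅_ _isInducedIn_ _isFreeOf_
infixl 8 _[_]
infixr 6 _∪ᴳ_
infixl 5 _+edges_

record _≅_ (G : Graph m) (H : Graph n) : Set where
  field
    vertices : Fin m ↔ Fin n
  open Inverse vertices public using (to; from)
  field
    adjacent : ∀ x y → _~_ G x y ⇔ _~_ H (to x) (to y)

-- The elements of S in increasing order.
element : (S : Subset n) → Fin ∣ S ∣ → Fin n
element (inside  ∷ S) zero    = zero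
element (inside  ∷ S) (suc i) = suc (element S i)
element (outside ∷ S) i       = suc (element S i)

element-injective : (S : Subset n) → ∀ {i j} → element S i ≡ element S j → i ≡ j
element-injective (inside  ∷ S) {zero}  {zero}  _  = refl
element-injective (inside  ∷ S) {suc i} {suc j} eq =
  cong suc (element-injective S (suc-injective eq))
element-injective (outside ∷ S)                 eq =
  element-injective S (suc-injective eq)

-- The subgraph induced by S, its vertices renumbered as Fin ∣ S ∣.
_[_] : Graph n → (S : Subset n) → Graph ∣ S ∣
G [ S ] = record
  { _~_      = λ i j → _~_ G (element S i) (element S j)
  ; ~-sym    = ~-sym G
  ; ~-irrefl = λ i≡j → ~-irrefl G (cong (element S) i≡j)
  ; _~?_     = λ i j → _~?_ G (element S i) (element S j)
  }

-- S may be empty, so the null graph is an induced subgraph of every graph.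
_isInducedIn_ : Graph m → Graph n → Set
H isInducedIn G = ∃ λ S → H ≅ G [ S ]

_isFreeOf_ : Graph n → Graph m → Set
G isFreeOf H = ¬ H isInducedIn G

K : ∀ n → Graph n
K n = record
  { _~_      = _≢_
  ; ~-sym    = λ x≢y y≡x → x≢y (sym y≡x)
  ; ~-irrefl = λ x≡y x≢y → x≢y x≡y
  ; _~?_     = λ x y → ¬? (x Fin.≟ y)
  }

P : ∀ n → Graph n
P n = record
  { _~_      = λ x y → toℕ y ≡ suc (toℕ x) ⊎ toℕ x ≡ suc (toℕ y)
  ; ~-sym    = swap
  ; ~-irrefl = λ { refl (inj₁ eq) → 1+n≢n (sym eq) ; refl (inj₂ eq) → 1+n≢n (sym eq) }
  ; _~?_     = λ x y → (toℕ y ℕ.≟ suc (toℕ x)) ⊎-dec (toℕ x ℕ.≟ suc (toℕ y))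
  }

-- Disjoint union; splitAt identifies Fin (m + n) with Fin m ⊎ Fin n.
_∪ᴳ_ : Graph m → Graph n → Graph (m ℕ.+ n)
_∪ᴳ_ {m} G H = record
  { _~_      = λ x y → Pointwise (_~_ G) (_~_ H) (splitAt m x) (splitAt m y)
  ; ~-sym    = ⊎-symmetric (~-sym G) (~-sym H)
  ; ~-irrefl = λ { refl → ⊎-irreflexive (~-irrefl G) (~-irrefl H) (⊎-refl refl refl) }
  ; _~?_     = λ x y → ⊎-decidable (_~?_ G) (_~?_ H) (splitAt m x) (splitAt m y)
  }

-- The graph with the listed (unordered) edges; loops in the list are ignored.
fromEdges : List (Fin n × Fin n) → Graph n
fromEdges es = record
  { _~_      = λ x y → x ≢ y × ((x , y) ∈ˡ es ⊎ (y , x) ∈ˡ es)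
  ; ~-sym    = λ { (x≢y , e) → (λ y≡x → x≢y (sym y≡x)) , swap e }
  ; ~-irrefl = λ { x≡y (x≢y , _) → x≢y x≡y }
  ; _~?_     = λ x y → ¬? (x Fin.≟ y) ×-dec (((x , y) ∈ˡ? es) ⊎-dec ((y , x) ∈ˡ? es))
  }
  where open DecMembership (≡-dec Fin._≟_ Fin._≟_) renaming (_∈?_ to _∈ˡ?_)

u₁ u₂ u₃ v₁ v₂ v₃ : Fin 6
u₁ = 0F
u₂ = 1F
u₃ = 2F
v₁ = 3F
v₂ = 4F
v₃ = 5F

-- The edges of the 6-cycle u₁ v₁ v₂ v₃ u₃ u₂.
C : List (Fin 6 × Fin 6)
C = (u₁ , v₁) ∷ (v₁ , v₂) ∷ (v₂ , v₃) ∷ (v₃ , u₃) ∷ (u₃ , u₂) ∷ (u₂ , u₁) ∷ []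

_+edges_ : List (Fin n × Fin n) → List (Fin n × Fin n) → Graph n
es +edges es′ = fromEdges (es ++ es′)

co-domino : Graph 6
co-domino = C +edges ((v₁ , v₃) ∷ (u₁ , u₃) ∷ [])

co-A : Graph 6
co-A = C +edges ((v₁ , v₃) ∷ (u₁ , u₃) ∷ (u₁ , v₃) ∷ [])

-- The largest k ≤ b satisfying Q, provided that Q 0.
greatest : {Q : Pred ℕ 0ℓ} → Decidable₁ Q → ℕ → ℕ
greatest Q? zero    = zero
greatest Q? (suc b) = if does (Q? (suc b)) then suc b else greatest Q? b

-- The smallest k ≤ b satisfying Q, provided that there is one.
least : {Q : Pred ℕ 0ℓ} → Decidable₁ Q → ℕ → ℕ
least Q? zero    = zero
least Q? (suc b) = if does (Q? zero) then zero else suc (least (Q? ∘ suc) b)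

module _ {Q : Pred ℕ 0ℓ} (Q? : Decidable₁ Q) where

  greatest-satisfies : ∀ b → Q 0 → Q (greatest Q? b)
  greatest-satisfies zero    q₀ = q₀
  greatest-satisfies (suc b) q₀ with Q? (suc b)
  ... | yes q = q
  ... | no  _ = greatest-satisfies b q₀

  greatest-maximal : ∀ b {k} → k ≤ b → Q k → k ≤ greatest Q? b
  greatest-maximal zero    k≤b q = k≤b
  greatest-maximal (suc b) k≤b q with Q? (suc b)
  ... | yes _ = k≤b
  ... | no ¬q with m≤n⇒m<n∨m≡n k≤b
  ...   | inj₁ (s≤s k≤b′) = greatest-maximal b k≤b′ q
  ...   | inj₂ refl       = contradiction q ¬q

least-satisfies : {Q : Pred ℕ 0ℓ} (Q? : Decidable₁ Q) → ∀ b → Q b → Q (least Q? b)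
least-satisfies Q? zero    q = q
least-satisfies Q? (suc b) q with Q? zero
... | yes q₀ = q₀
... | no  _  = least-satisfies (Q? ∘ suc) b q

least-minimal : {Q : Pred ℕ 0ℓ} (Q? : Decidable₁ Q) → ∀ b {k} → Q k → least Q? b ≤ k
least-minimal Q? zero    q = z≤n
least-minimal Q? (suc b) {k} q with Q? zero
... | yes _ = z≤n
least-minimal Q? (suc b) {zero}  q | no ¬q₀ = contradiction q ¬q₀
least-minimal Q? (suc b) {suc k} q | no _   = s≤s (least-minimal (Q? ∘ suc) b q)

IsClique : Graph n → Subset n → Set
IsClique G S = ∀ x y → x ∈ S → y ∈ S → x ≢ y → _~_ G x y

isClique? : (G : Graph n) → Decidable₁ (IsClique G)
isClique? G S = all? λ x → all? λ y →
  (x ∈? S) →-dec (y ∈? S) →-dec ¬? (x Fin.≟ y) →-dec _~?_ G x y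

HasClique : Graph n → ℕ → Set
HasClique G k = ∃ λ S → IsClique G S × ∣ S ∣ ≡ k

hasClique? : (G : Graph n) → Decidable₁ (HasClique G)
hasClique? G k = anySubset? λ S → isClique? G S ×-dec (∣ S ∣ ℕ.≟ k)

ω : Graph n → ℕ
ω {n} G = greatest (hasClique? G) n

ω-attained : (G : Graph n) → HasClique G (ω G)
ω-attained {n} G = greatest-satisfies (hasClique? G) n
  (⊥ , (λ x y x∈⊥ → contradiction x∈⊥ ∉⊥) , ∣⊥∣≡0 n)

ω-maximal : (G : Graph n) (S : Subset n) → IsClique G S → ∣ S ∣ ≤ ω G
ω-maximal {n} G S cl = greatest-maximal (hasClique? G) n (∣p∣≤n S) (S , cl , refl)

IsColouring : Graph n → ∀ {k} → (Fin n → Fin k) → Set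
IsColouring G c = ∀ x y → _~_ G x y → c x ≢ c y

Colourable : Graph n → ℕ → Set
Colourable {n} G k = Σ (Fin n → Fin k) (IsColouring G)

-- Functions Fin n → Fin k are enumerated by Fin (k ^ n).
colourable? : (G : Graph n) → Decidable₁ (Colourable G)
colourable? {n} G k = map′
  (λ { (i , col) → finToFun i , col })
  (λ { (c , col) → funToFin c , λ x y x~y eq →
         col x y x~y (trans (sym (finToFun-funToFin c x)) (trans eq (finToFun-funToFin c y))) })
  (any? λ (i : Fin (k ℕ.^ n)) → all? λ x → all? λ y →
     _~?_ G x y →-dec ¬? (finToFun i x Fin.≟ finToFun i y))

-- A graph on n vertices is n-colourable, so the search up to n succeeds.
χ : Graph n → ℕ
χ {n} G = least (colourable? G) n

χ-colourable : (G : Graph n) → Colourable G (χ G)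
χ-colourable {n} G = least-satisfies (colourable? G) n
  ((λ x → x) , λ x y x~y x≡y → ~-irrefl G x≡y x~y)

χ-minimal : (G : Graph n) → ∀ {k} → Colourable G k → χ G ≤ k
χ-minimal {n} G = least-minimal (colourable? G) n

-- The open neighbourhood: x ∉ N G x, so G -ᴳ N G x retains x.
N : Graph n → Fin n → Subset n
N G x = tabulate λ y → does (_~?_ G x y)

infixl 8 _-ᴳ_

_-ᴳ_ : Graph n → (S : Subset n) → Graph ∣ ∁ S ∣
G -ᴳ S = G [ ∁ S ]

D₁ : Graph n → Subset n
D₁ G = tabulate λ x → does (ω (G -ᴳ N G x) ≤? 2)

D₂ : Graph n → Subset n
D₂ G = ∁ (D₁ G)

{-# OPTIONS --safe #-}

-- Suppose that G is not 7-colourable and that a graph H occurs in G on some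
-- seed vertices.  Classify the vertices of G by their adjacencies to the seed
-- (their types).  The vertices anticomplete to an edge of the seed span a
-- disjoint union of cliques, because G is (P₃ ∪ P₂)-free; so three colours
-- suffice for them, and two once K₃ ∪ K₂ is excluded.  A set of types spans an
-- independent set if an edge between two of its vertices would create, together
-- with the seed, a graph already known not to occur in G.  If the vertices can be
-- split in this way at a cost of seven colours, then H does not occur in G after
-- all.  This excludes in turn K₃ ∪ K₂, H₁, …, H₅, the kite, the tadpole, the
-- butterfly, K₃, K₂ and finally the null graph, which is absurd.

module Submission where

open import Defs
open import Data.Bool.Base using (Bool; true; false; T; if_then_else_; _∧_; _∨_)
import Data.Bool.Properties as Bool
open import Data.Fin using (#_)
open import Data.Fin.Base as Fin using (Fin; zero; suc)
import Data.Fin.Properties as Fin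
open import Data.Fin.Subset using (Subset; inside; outside; _∈_; ∣_∣; _∩_; ⊤)
open import Data.Fin.Subset.Properties using (x∈p∩q⁻)
open import Data.List.Base using (List; []; _∷_; map)
open import Data.List.Membership.Propositional using () renaming (_∈_ to _∈ˡ_)
open import Data.List.Relation.Unary.All as All using (All; []; _∷_)
open import Data.List.Relation.Unary.AllPairs as AllPairs using (AllPairs; _∷_)
open import Data.List.Relation.Unary.Any as Any using (Any; here; there)
open import Data.Nat.Base as ℕ using (ℕ; zero; suc; _≤_; _+_; _/_; _%_; _≡ᵇ_)
open import Data.Nat.ListAction using (sum)
import Data.Nat.Properties as ℕ
open import Data.Product.Base using (Σ; ∃; _×_; _,_; proj₁; proj₂)
open import Data.Sum.Base using (_⊎_; inj₁; inj₂)
open import Data.Unit.Base using (tt)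
open import Data.Vec.Base as Vec using (Vec; []; _∷_; lookup; tabulate; here; there)
import Data.Vec.Properties as Vec
open import Data.Vec.Relation.Binary.Pointwise.Inductive as Pointwise
  using (Pointwise; []; _∷_)
open import Function.Base using (_∘_)
open import Function.Bundles using (_⇔_; mk⇔; mk↔ₛ′)
open import Relation.Binary.Definitions using (tri<; tri≈; tri>)
open import Relation.Binary.PropositionalEquality
  using (_≡_; _≢_; refl; sym; trans; cong; subst; subst₂; ≢-sym)
open import Relation.Nullary.Decidable
  using (Dec; yes; no; does; True; toWitness; map′; ¬?; T?; _×-dec_; _⊎-dec_; _→-dec_;
         dec-true; dec-false; decidable-stable)
open import Relation.Nullary.Negation using (¬_; contradiction)

private
  variable
    k l m n : ℕ
    A B : Set

-- Patterns and their induced occurrences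

infixl 5 _▹_ _▸_
infixr 5 _◂_

-- In H ▹ S the new vertex gets index zero, and S lists its adjacencies to
-- the vertices of H.
data Pattern : ℕ → Set where
  ∅   : Pattern 0
  _▹_ : Pattern k → Vec Bool k → Pattern (suc k)

edge : Pattern k → Fin k → Fin k → Bool
edge (H ▹ S) zero    zero    = false
edge (H ▹ S) zero    (suc j) = lookup S j
edge (H ▹ S) (suc i) zero    = lookup S i
edge (H ▹ S) (suc i) (suc j) = edge H i j

row : Pattern k → Fin k → Vec Bool k
row H i = tabulate (edge H i)

-- Non-adjacency does not keep a vertex apart from itself, so distinctness is asked for explicitly;
-- it makes occurrences injective. The adjacency is arbitrary because hosts are both patterns and
-- graphs.
Attached : (A → A → Bool) → Vec Bool k → A → Vec A k → Set
Attached adj S v = Pointwise (λ b w → v ≢ w × adj v w ≡ b) S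

data Occurs {A : Set} (adj : A → A → Bool) : Pattern k → Vec A k → Set where
  []  : Occurs adj ∅ []
  _∷_ : ∀ {H : Pattern k} {S v vs} → Attached adj S v vs → Occurs adj H vs →
        Occurs adj (H ▹ S) (v ∷ vs)

occurs-map : ∀ {adj : A → A → Bool} {adj′ : B → B → Bool} (f : A → B) →
             (∀ {x y} → f x ≡ f y → x ≡ y) →
             (∀ x y → adj′ (f x) (f y) ≡ adj x y) →
             ∀ {H : Pattern k} {vs} → Occurs adj H vs → Occurs adj′ H (Vec.map f vs)
occurs-map f inj pres []       = []
occurs-map {adj = adj} {adj′} f inj pres (a ∷ o) = go a ∷ occurs-map f inj pres o
  where
  go : ∀ {k} {S : Vec Bool k} {v vs} →
       Attached adj S v vs → Attached adj′ S (f v) (Vec.map f vs)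
  go []              = []
  go ((v≢w , e) ∷ a) = (v≢w ∘ inj , trans (pres _ _) e) ∷ go a

does⇒ : (a? : Dec A) → does a? ≡ true → A
does⇒ (yes a) _ = a

-- Deciding whether one pattern contains another

anyOf : Subset k → (Fin k → Bool) → Bool
anyOf []      f = false
anyOf (b ∷ D) f = (b ∧ f zero) ∨ anyOf D (f ∘ suc)

anyOf-sound : ∀ (D : Subset k) f → T (anyOf D f) → ∃ λ v → v ∈ D × T (f v)
anyOf-sound (b ∷ D) f t with b | f zero in f≡
... | true  | true  = zero , here , subst T (sym f≡) tt
... | true  | false = let v , v∈D , t′ = anyOf-sound D _ t in suc v , there v∈D , t′
... | false | _     = let v , v∈D , t′ = anyOf-sound D _ t in suc v , there v∈D , t′

Separate : (H : Pattern k) → Bool → Fin k → Fin k → Set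
Separate H b v w = v ≢ w × edge H v w ≡ b

separate? : ∀ (H : Pattern k) b v w → Dec (Separate H b v w)
separate? H b v w = ¬? (v Fin.≟ w) ×-dec (edge H v w Bool.≟ b)

Table : ℕ → Set
Table k = Vec (Subset k) k

table : Pattern k → Bool → Table k
table H b = tabulate λ v → tabulate λ w → does (separate? H b v w)

table-sound : ∀ (H : Pattern k) b {v w} → w ∈ lookup (table H b) v → Separate H b v w
table-sound H b {v} {w} w∈ =
  does⇒ (separate? H b v w) (trans (sym lookup-table) (Vec.[]=⇒lookup w∈))
  where
  lookup-table : lookup (lookup (table H b) v) w ≡ does (separate? H b v w)
  lookup-table =
    trans (cong (λ r → lookup r w) (Vec.lookup∘tabulate _ v)) (Vec.lookup∘tabulate _ w)

restrict : Subset k → Subset k → Vec Bool m → Vec (Subset k) m → Vec (Subset k) m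
restrict r s = Vec.zipWith λ b D → D ∩ (if b then r else s)

-- Backtracking with forward checking: Ds lists the images still available for
-- each vertex of the pattern.
search : Table k → Table k → Pattern m → Vec (Subset k) m → Bool
search t f ∅       []       = true
search t f (F ▹ S) (D ∷ Ds) =
  anyOf D λ v → search t f F (restrict (lookup t v) (lookup f v) S Ds)

-- The domains appear in the conclusion for the sake of the induction: lying in the restricted
-- domains is what makes the later images correctly attached to `v`.
search-sound : ∀ (H : Pattern k) (F : Pattern m) Ds →
               T (search (table H true) (table H false) F Ds) →
               ∃ λ is → Occurs (edge H) F is × Pointwise _∈_ is Ds
search-sound H ∅       []       _ = [] , [] , []
search-sound H (F ▹ S) (D ∷ Ds) t =
  let v , v∈D , t′    = anyOf-sound D _ t
      is , o , is∈    = search-sound H F _ t′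
      attached , is∈′ = unrestrict S Ds is∈
  in  v ∷ is , attached ∷ o , v∈D ∷ is∈′
  where
  allowed : Bool → Fin _ → Subset _
  allowed b v = lookup (table H b) v

  side : ∀ b {v i} → i ∈ (if b then allowed true v else allowed false v) → Separate H b v i
  side true  = table-sound H true
  side false = table-sound H false

  unrestrict : ∀ {m} S (Ds : Vec (Subset _) m) {v is} →
               Pointwise _∈_ is (restrict (allowed true v) (allowed false v) S Ds) →
               Attached (edge H) S v is × Pointwise _∈_ is Ds
  unrestrict []      []       []        = [] , []
  unrestrict (b ∷ S) (D ∷ Ds) (i∈ ∷ is) =
    let i∈D , i∈side = x∈p∩q⁻ D _ i∈
        a , is′      = unrestrict S Ds is
    in  side b i∈side ∷ a , i∈D ∷ is′

Patterns : Set
Patterns = List (∃ Pattern)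

_◂_ : Pattern k → Patterns → Patterns
F ◂ Fs = (_ , F) ∷ Fs

-- The tables are arguments of Hit so that they are evaluated only once per graph.
Hit : Table k → Table k → ∃ Pattern → Set
Hit t f (_ , F) = T (search t f F (Vec.replicate _ ⊤))

Excluded : Patterns → Pattern k → Set
Excluded Fs H = Any (Hit (table H true) (table H false)) Fs

excluded? : ∀ Fs (H : Pattern k) → Dec (Excluded Fs H)
excluded? Fs H = hit? (table H true) (table H false)
  where
  hit? : ∀ t f → Dec (Any (Hit t f) Fs)
  hit? t f = Any.any? (λ _ → T? _) Fs

-- Certificates for seven colours

all-vec? : ∀ {k} {Q : Vec Bool k → Set} → (∀ S → Dec (Q S)) → Dec (∀ S → Q S)
all-vec? {zero}  Q? = map′ (λ { q [] → q }) (λ q → q []) (Q? [])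
all-vec? {suc k} Q? = map′
  (λ { (q , r) (true ∷ S) → q S ; (q , r) (false ∷ S) → r S })
  (λ q → (λ S → q (true ∷ S)) , (λ S → q (false ∷ S)))
  (all-vec? (λ S → Q? (true ∷ S)) ×-dec all-vec? (λ S → Q? (false ∷ S)))

-- Least significant digit first: vertex j is adjacent to the new vertex of H ▸ m
-- iff 2ʲ occurs in m.
bits : ∀ k → ℕ → Vec Bool k
bits zero    m = []
bits (suc k) m = (m % 2 ≡ᵇ 1) ∷ bits k (m / 2)

_▸_ : Pattern k → ℕ → Pattern (suc k)
H ▸ m = H ▹ bits _ m

-- anti₂ i j and anti₃ i j consist of the vertices anticomplete to the edge i j.
data Part (k : ℕ) : Set where
  anti₂ anti₃ : Fin k → Fin k → Part k
  indep       : List (Vec Bool k) → Part k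

width : Part k → ℕ
width (anti₂ _ _) = 2
width (anti₃ _ _) = 3
width (indep _)   = 1

_∈ᵖ_ : Vec Bool k → Part k → Set
S ∈ᵖ anti₂ i j = lookup S i ≡ false × lookup S j ≡ false
S ∈ᵖ anti₃ i j = lookup S i ≡ false × lookup S j ≡ false
S ∈ᵖ indep l   = S ∈ˡ l

_∈ᵖ?_ : (S : Vec Bool k) (p : Part k) → Dec (S ∈ᵖ p)
S ∈ᵖ? anti₂ i j = (lookup S i Bool.≟ false) ×-dec (lookup S j Bool.≟ false)
S ∈ᵖ? anti₃ i j = (lookup S i Bool.≟ false) ×-dec (lookup S j Bool.≟ false)
S ∈ᵖ? indep l   = Any.any? (Vec.≡-dec Bool._≟_ S) l

P₃∪P₂ K₃∪K₂ : Pattern 5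
P₃∪P₂ = ∅ ▸ 0 ▸ 1 ▸ 0 ▸ 1 ▸ 1
K₃∪K₂ = ∅ ▸ 0 ▸ 1 ▸ 0 ▸ 1 ▸ 3

K₄ : Pattern 4
K₄ = ∅ ▸ 0 ▸ 1 ▸ 3 ▸ 7

-- What an edge between vertices of types `S` and `S′` outside the seed would create; the leading
-- `true` is that edge.
join : Pattern k → Vec Bool k → Vec Bool k → Pattern (2 + k)
join H S S′ = H ▹ S ▹ (true ∷ S′)

-- The last clause of Valid concerns edges at the seed vertices, for which join
-- would contain the same vertex twice.
Valid : Patterns → Pattern k → Part k → Set
Valid Fs H (anti₂ i j) = edge H i j ≡ true × Excluded Fs P₃∪P₂ × Excluded Fs K₃∪K₂
Valid Fs H (anti₃ i j) = edge H i j ≡ true × Excluded Fs P₃∪P₂ × Excluded Fs K₄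
Valid Fs H (indep l)   =
  (All (λ S → Excluded Fs (join H S S)) l ×
   AllPairs (λ S S′ → Excluded Fs (join H S S′)) l) ×
  (∀ i → row H i ∈ˡ l → All (λ S → lookup S i ≡ false) l)

valid? : ∀ Fs (H : Pattern k) p → Dec (Valid Fs H p)
valid? Fs H (anti₂ i j) =
  (edge H i j Bool.≟ true) ×-dec excluded? Fs P₃∪P₂ ×-dec excluded? Fs K₃∪K₂
valid? Fs H (anti₃ i j) =
  (edge H i j Bool.≟ true) ×-dec excluded? Fs P₃∪P₂ ×-dec excluded? Fs K₄
valid? Fs H (indep l)   =
  (All.all? (λ S → excluded? Fs (join H S S)) l ×-dec
   AllPairs.allPairs? (λ S S′ → excluded? Fs (join H S S′)) l) ×-dec
  Fin.all? (λ i →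
    (row H i ∈ᵖ? indep l) →-dec All.all? (λ S → lookup S i Bool.≟ false) l)

-- A type in no part must not be realised. Excluding `H ▹ S` rules out vertices outside the seed
-- only, hence the separate comparison with the rows of the seed.
Covered : Patterns → Pattern k → List (Part k) → Vec Bool k → Set
Covered Fs H ps S = Any (S ∈ᵖ_) ps ⊎ Excluded Fs (H ▹ S) × (∀ i → row H i ≢ S)

covered? : ∀ Fs (H : Pattern k) ps S → Dec (Covered Fs H ps S)
covered? Fs H ps S = Any.any? (S ∈ᵖ?_) ps ⊎-dec
  (excluded? Fs (H ▹ S) ×-dec Fin.all? (λ i → ¬? (Vec.≡-dec Bool._≟_ (row H i) S)))

Certificate : Patterns → Pattern k → List (Part k) → Set
Certificate Fs H ps =
  sum (map width ps) ≤ 7 × All (Valid Fs H) ps × (∀ S → Covered Fs H ps S)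

certificate? : ∀ Fs (H : Pattern k) ps → Dec (Certificate Fs H ps)
certificate? Fs H ps =
  (sum (map width ps) ℕ.≤? 7) ×-dec All.all? (valid? Fs H) ps ×-dec
  all-vec? (covered? Fs H ps)

-- Occurrences of patterns in a graph

module _ (G : Graph n) where
  open Graph G

  adj : Fin n → Fin n → Bool
  adj x y = does (x ~? y)

  adj⇒~ : ∀ {x y} → adj x y ≡ true → x ~ y
  adj⇒~ = does⇒ (_ ~? _)

  ~⇒adj : ∀ {x y} → x ~ y → adj x y ≡ true
  ~⇒adj x~y = dec-true (_ ~? _) x~y

  ≁⇒adj : ∀ {x y} → ¬ x ~ y → adj x y ≡ false
  ≁⇒adj x≁y = dec-false (_ ~? _) x≁y

  ~⇒≢ : ∀ {x y} → x ~ y → x ≢ y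
  ~⇒≢ x~y x≡y = ~-irrefl x≡y x~y

  adj-sym : ∀ x y → adj x y ≡ adj y x
  adj-sym x y with x ~? y
  ... | yes x~y = sym (~⇒adj (~-sym x~y))
  ... | no x≁y  = sym (≁⇒adj (x≁y ∘ ~-sym))

  Forbidden : Pattern k → Set
  Forbidden H = ∀ vs → ¬ Occurs adj H vs

  occurs-edge : ∀ {H : Pattern k} {vs} → Occurs adj H vs →
                ∀ i j → adj (lookup vs i) (lookup vs j) ≡ edge H i j
  occurs-edge (a ∷ o) zero    zero    = ≁⇒adj (~-irrefl refl)
  occurs-edge (a ∷ o) zero    (suc j) = proj₂ (Pointwise.lookup a j)
  occurs-edge (a ∷ o) (suc i) zero    = trans (adj-sym _ _) (proj₂ (Pointwise.lookup a i))
  occurs-edge (a ∷ o) (suc i) (suc j) = occurs-edge o i j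

  occurs-injective : ∀ {H : Pattern k} {vs} → Occurs adj H vs →
                     ∀ {i j} → lookup vs i ≡ lookup vs j → i ≡ j
  occurs-injective (a ∷ o) {zero}  {zero}  e = refl
  occurs-injective (a ∷ o) {zero}  {suc j} e = contradiction e (proj₁ (Pointwise.lookup a j))
  occurs-injective (a ∷ o) {suc i} {zero}  e =
    contradiction (sym e) (proj₁ (Pointwise.lookup a i))
  occurs-injective (a ∷ o) {suc i} {suc j} e = cong suc (occurs-injective o e)

  AllForbidden : Patterns → Set
  AllForbidden Fs = All (λ (_ , F) → Forbidden F) Fs

  -- Induced containment is transitive: an occurrence of `H` would carry into `G` the forbidden
  -- pattern that the search found inside `H`.
  excluded⇒forbidden : ∀ {Fs} → AllForbidden Fs → {H : Pattern k} → Excluded Fs H → Forbidden H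
  excluded⇒forbidden (f ∷ _) {H} (here c) vs o with search-sound H _ _ c
  ... | is , o′ , _ = f _ (occurs-map (lookup vs) (occurs-injective o) (occurs-edge o) o′)
  excluded⇒forbidden (_ ∷ fs) (there e) = excluded⇒forbidden fs e

  -- Colourings of vertex sets

  ColourableOn : (Fin n → Set) → ℕ → Set
  ColourableOn Q k = Σ (Fin n → ℕ) λ c →
    (∀ v → Q v → c v ℕ.< k) × (∀ x y → x ~ y → Q x → Q y → c x ≢ c y)

  -- Shifting the second palette by `k` makes the palettes disjoint; a vertex in both sets keeps its
  -- colour from `Q`.
  colour-union : ∀ {Q R : Fin n → Set} → (∀ v → Dec (Q v)) →
                 ColourableOn Q k → ColourableOn R l → ColourableOn (λ v → Q v ⊎ R v) (k + l)
  colour-union {k} {l} {Q} {R} Q? (c , c< , c-proper) (d , d< , d-proper) =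
    (λ v → e (Q? v)) , (λ v → e< (Q? v)) , e-proper
    where
    e : ∀ {v} → Dec (Q v) → ℕ
    e {v} (yes _) = c v
    e {v} (no _)  = k + d v

    other : ∀ {v} → Q v ⊎ R v → ¬ Q v → R v
    other (inj₁ q) ¬q = contradiction q ¬q
    other (inj₂ r) _  = r

    e< : ∀ {v} q? → Q v ⊎ R v → e {v} q? ℕ.< k + l
    e< (yes q) _ = ℕ.<-≤-trans (c< _ q) (ℕ.m≤m+n k l)
    e< (no ¬q) r = ℕ.+-monoʳ-< k (d< _ (other r ¬q))

    e-proper : ∀ x y → x ~ y → Q x ⊎ R x → Q y ⊎ R y → e (Q? x) ≢ e (Q? y)
    e-proper x y x~y qx qy eq with Q? x | Q? y
    ... | yes p | yes q = c-proper x y x~y p q eq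
    ... | yes p | no _  = ℕ.<⇒≢ (ℕ.<-≤-trans (c< x p) (ℕ.m≤m+n k _)) eq
    ... | no _  | yes q = ℕ.<⇒≢ (ℕ.<-≤-trans (c< y q) (ℕ.m≤m+n k _)) (sym eq)
    ... | no p  | no q  = d-proper x y x~y (other qx p) (other qy q) (ℕ.+-cancelˡ-≡ k _ _ eq)

  -- Directed paths, for the orientation of every edge towards its smaller end; `w` counts edges, so
  -- there are `w + 1` vertices.
  Descent : (Fin n → Set) → ℕ → Fin n → Set
  Descent Q zero    v = Q v
  Descent Q (suc w) v = Q v × ∃ λ u → u Fin.< v × u ~ v × Descent Q w u

  descent? : ∀ {Q} → (∀ v → Dec (Q v)) → ∀ w v → Dec (Descent Q w v)
  descent? Q? zero    v = Q? v
  descent? Q? (suc w) v =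
    Q? v ×-dec Fin.any? λ u → (u Fin.<? v) ×-dec (u ~? v) ×-dec descent? Q? w u

  -- The path ends in `Descent Q 1`, and the lower neighbour of its end supplies the additional
  -- edge.
  descent-suc : ∀ {Q} w {v} → Descent (Descent Q 1) w v → Descent Q (suc w) v
  descent-suc zero    d                             = d
  descent-suc (suc w) ((q , _) , u , u<v , u~v , d) = q , u , u<v , u~v , descent-suc w d

  -- Gallai–Roy: the vertices without a lower neighbour form an independent set,
  -- and removing them shortens all descending paths.
  colour-by-descent : ∀ w {Q} → (∀ v → Dec (Q v)) → (∀ v → ¬ Descent Q w v) →
                      ColourableOn Q w
  colour-by-descent zero Q? none =
    (λ _ → 0) , (λ v q → contradiction q (none v)) , λ x _ _ q → contradiction q (none x)
  colour-by-descent (suc w) {Q} Q? none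
    with colour-by-descent w (descent? Q? 1) (λ v → none v ∘ descent-suc w)
  ... | c , c< , c-proper = (λ v → e (descent? Q? 1 v)) , (λ v _ → e< (descent? Q? 1 v)) , proper
    where
    e : ∀ {v} → Dec (Descent Q 1 v) → ℕ
    e {v} (yes _) = suc (c v)
    e     (no _)  = zero

    e< : ∀ {v} d? → e {v} d? ℕ.< suc w
    e< (yes d) = ℕ.s≤s (c< _ d)
    e< (no _)  = ℕ.z<s

    proper : ∀ x y → x ~ y → Q x → Q y → e (descent? Q? 1 x) ≢ e (descent? Q? 1 y)
    proper x y x~y qx qy eq with descent? Q? 1 x | descent? Q? 1 y
    ... | yes p | yes q = c-proper x y x~y p q (ℕ.suc-injective eq)
    ... | no p  | no q  with Fin.<-cmp x y
    ...   | tri< x<y _ _ = q (qy , x , x<y , x~y , qx)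
    ...   | tri≈ _ x≡y _ = ~-irrefl x≡y x~y
    ...   | tri> _ _ y<x = p (qx , y , y<x , ~-sym x~y , qy)

  -- near true is K₃∪K₂ and near false is P₃∪P₂.
  near : Bool → Pattern 5
  near b = ∅ ▸ 0 ▸ 1 ▸ 0 ▸ 1 ▹ (true ∷ b ∷ false ∷ false ∷ [])

  -- Vertices anticomplete to an edge

  module _ {p q : Fin n} (p~q : p ~ q) where

    Anti : Fin n → Set
    Anti v = adj v p ≡ false × adj v q ≡ false

    anti? : ∀ v → Dec (Anti v)
    anti? v = (adj v p Bool.≟ false) ×-dec (adj v q Bool.≟ false)

    anti-attached : ∀ {v} → Anti v → Attached adj (false ∷ false ∷ []) v (p ∷ q ∷ [])
    anti-attached (v≁p , v≁q) =
      ((λ { refl → contradiction (trans (sym (~⇒adj p~q)) v≁q) λ () }) , v≁p) ∷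
      ((λ { refl → contradiction (trans (sym (~⇒adj (~-sym p~q))) v≁p) λ () }) , v≁q) ∷ []

    -- Letting the adjacency of the two ends choose the pattern treats induced paths and triangles
    -- together.
    anti-path : ∀ {u v w} → Anti u → Anti v → Anti w → u ~ v → v ~ w → u ≢ w →
                Occurs adj (near (adj u w)) (u ∷ v ∷ w ∷ p ∷ q ∷ [])
    anti-path u-anti v-anti w-anti u~v v~w u≢w =
      ((~⇒≢ u~v , ~⇒adj u~v) ∷ (u≢w , refl) ∷ anti-attached u-anti) ∷
      ((~⇒≢ v~w , ~⇒adj v~w) ∷ anti-attached v-anti) ∷
      anti-attached w-anti ∷
      ((~⇒≢ p~q , ~⇒adj p~q) ∷ []) ∷ [] ∷ []

    -- A descending path of two edges would be an induced path or a triangle, and either is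
    -- forbidden beside the edge `p~q`.
    anti-2-colourable : Forbidden P₃∪P₂ → Forbidden K₃∪K₂ → ColourableOn Anti 2
    anti-2-colourable P₃∪P₂-free K₃∪K₂-free = colour-by-descent 2 anti? none
      where
      near-free : ∀ b → Forbidden (near b)
      near-free true  = K₃∪K₂-free
      near-free false = P₃∪P₂-free

      none : ∀ v → ¬ Descent Anti 2 v
      none x (x-anti , y , y<x , y~x , y-anti , z , z<y , z~y , z-anti) =
        near-free _ _ (anti-path x-anti y-anti z-anti (~-sym y~x) (~-sym z~y)
          (≢-sym (Fin.<⇒≢ (Fin.<-trans z<y y<x))))

    anti-3-colourable : Forbidden P₃∪P₂ → Forbidden K₄ → ColourableOn Anti 3
    anti-3-colourable P₃∪P₂-free K₄-free = colour-by-descent 3 anti? none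
      where
      -- Adjacency is transitive on distinct vertices of `Anti`, so a descending path of three edges
      -- spans a `K₄`.
      close : ∀ {u v w} → Anti u → Anti v → Anti w → u ~ v → v ~ w → u ≢ w → u ~ w
      close {u} {w = w} u-anti v-anti w-anti u~v v~w u≢w
        with adj u w in eq | anti-path u-anti v-anti w-anti u~v v~w u≢w
      ... | true  | _ = adj⇒~ eq
      ... | false | o = contradiction o (P₃∪P₂-free _)

      none : ∀ v → ¬ Descent Anti 3 v
      none a (a-anti , b , b<a , b~a , b-anti , c , c<b , c~b , c-anti , d , d<c , d~c , d-anti) =
        K₄-free _
          ((link a~b ∷ link a~c ∷ link a~d ∷ []) ∷ (link b~c ∷ link b~d ∷ []) ∷
           (link c~d ∷ []) ∷ [] ∷ [])
        where
        link : ∀ {x y} → x ~ y → x ≢ y × adj x y ≡ true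
        link x~y = ~⇒≢ x~y , ~⇒adj x~y
        a~b = ~-sym b~a
        b~c = ~-sym c~b
        c~d = ~-sym d~c
        a~c = close a-anti b-anti c-anti a~b b~c (≢-sym (Fin.<⇒≢ (Fin.<-trans c<b b<a)))
        b~d = close b-anti c-anti d-anti b~c c~d (≢-sym (Fin.<⇒≢ (Fin.<-trans d<c c<b)))
        a~d = close a-anti b-anti d-anti a~b b~d
          (≢-sym (Fin.<⇒≢ (Fin.<-trans d<c (Fin.<-trans c<b b<a))))

  -- From a certificate to a colouring

  module _ {Fs} (fs : AllForbidden Fs) {H : Pattern k} {vs} (o : Occurs adj H vs) where

    type : Fin n → Vec Bool k
    type v = Vec.map (adj v) vs

    lookup-type : ∀ v i → lookup (type v) i ≡ adj v (lookup vs i)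
    lookup-type v i = Vec.lookup-map i (adj v) vs

    type-seed : ∀ i → type (lookup vs i) ≡ row H i
    type-seed i = trans (sym (Vec.tabulate∘lookup _))
      (Vec.tabulate-cong λ j → trans (lookup-type _ j) (occurs-edge o i j))

    Seed : Fin n → Set
    Seed v = ∃ λ i → v ≡ lookup vs i

    seed? : ∀ v → Dec (Seed v)
    seed? v = Fin.any? λ i → v Fin.≟ lookup vs i

    attached : ∀ {v} → ¬ Seed v → Attached adj (type v) v vs
    attached {v} ¬seed = go (λ i e → ¬seed (i , e))
      where
      go : ∀ {m} {ws : Vec (Fin n) m} → (∀ i → v ≢ lookup ws i) →
           Attached adj (Vec.map (adj v) ws) v ws
      go {ws = []}    _ = []
      go {ws = _ ∷ _} ≢ = (≢ zero , refl) ∷ go (≢ ∘ suc)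

    seed-adj : ∀ {x y} i → x ≡ lookup vs i → x ~ y → lookup (type y) i ≡ true
    seed-adj i refl x~y = trans (lookup-type _ i) (~⇒adj (~-sym x~y))

    pair-occurs : ∀ {x y} → ¬ Seed x → ¬ Seed y → x ~ y →
                  Occurs adj (join H (type x) (type y)) (y ∷ x ∷ vs)
    pair-occurs x∉ y∉ x~y =
      ((~⇒≢ (~-sym x~y) , ~⇒adj (~-sym x~y)) ∷ attached y∉) ∷ attached x∉ ∷ o

    -- `AllPairs` compares different positions of the list only, so two adjacent vertices of equal
    -- type are left to the diagonal hypothesis. The order in the list decides the orientation of
    -- `R`.
    allPairs-lookup : ∀ {R : Vec Bool k → Vec Bool k → Set} {l S S′} →
                      All (λ S → R S S) l → AllPairs R l → S ∈ˡ l → S′ ∈ˡ l → R S S′ ⊎ R S′ S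
    allPairs-lookup (r ∷ _)  _        (here refl) (here refl) = inj₁ r
    allPairs-lookup _        (rs ∷ _) (here refl) (there q)   = inj₁ (All.lookup rs q)
    allPairs-lookup _        (rs ∷ _) (there p)   (here refl) = inj₂ (All.lookup rs p)
    allPairs-lookup (_ ∷ rs) (_ ∷ ps) (there p)   (there q)   = allPairs-lookup rs ps p q

    via-anti : ∀ i j {w} → edge H i j ≡ true →
               (∀ (p~q : lookup vs i ~ lookup vs j) → ColourableOn (Anti p~q) w) →
               ColourableOn (λ v → lookup (type v) i ≡ false × lookup (type v) j ≡ false) w
    via-anti i j e colouring with colouring (adj⇒~ (trans (occurs-edge o i j) e))
    ... | c , c< , proper =
      c , (λ v q → c< v (unfold q)) , λ x y x~y qx qy → proper x y x~y (unfold qx) (unfold qy)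
      where
      unfold : ∀ {v} → lookup (type v) i ≡ false × lookup (type v) j ≡ false →
               adj v (lookup vs i) ≡ false × adj v (lookup vs j) ≡ false
      unfold {v} (e , e′) = trans (sym (lookup-type v i)) e , trans (sym (lookup-type v j)) e′

    part-colourable : ∀ p → Valid Fs H p → ColourableOn (λ v → type v ∈ᵖ p) (width p)
    part-colourable (anti₂ i j) (e , e₁ , e₂) = via-anti i j e λ p~q →
      anti-2-colourable p~q (excluded⇒forbidden fs e₁) (excluded⇒forbidden fs e₂)
    part-colourable (anti₃ i j) (e , e₁ , e₂) = via-anti i j e λ p~q →
      anti-3-colourable p~q (excluded⇒forbidden fs e₁) (excluded⇒forbidden fs e₂)
    part-colourable (indep l) ((diag , pairs) , seeds) =
      (λ _ → 0) , (λ _ _ → ℕ.z<s) , λ x y x~y Sx Sy _ → independent x~y Sx Sy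
      where
      -- A neighbour of seed vertex `i` has `true` at position `i` of its type, whereas the last
      -- clause of `Valid` makes every type of the part `false` there.
      seed-independent : ∀ {x y} → Seed x → x ~ y → type x ∈ˡ l → ¬ type y ∈ˡ l
      seed-independent (i , refl) x~y Sx Sy = contradiction
        (trans (sym (seed-adj i refl x~y))
               (All.lookup (seeds i (subst (_∈ˡ l) (type-seed i) Sx)) Sy))
        λ ()

      independent : ∀ {x y} → x ~ y → type x ∈ˡ l → ¬ type y ∈ˡ l
      independent {x} {y} x~y Sx Sy with seed? x | seed? y
      ... | yes x∈ | _      = seed-independent x∈ x~y Sx Sy
      ... | no _   | yes y∈ = seed-independent y∈ (~-sym x~y) Sy Sx
      ... | no x∉ | no y∉ with allPairs-lookup diag pairs Sx Sy
      ...   | inj₁ e = excluded⇒forbidden fs e _ (pair-occurs x∉ y∉ x~y)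
      ...   | inj₂ e = excluded⇒forbidden fs e _ (pair-occurs y∉ x∉ (~-sym x~y))

    parts-colourable : ∀ ps → All (Valid Fs H) ps →
                       ColourableOn (λ v → Any (type v ∈ᵖ_) ps) (sum (map width ps))
    parts-colourable []       []           = (λ _ → 0) , (λ _ ()) , λ _ _ _ ()
    parts-colourable (p ∷ ps) (valid ∷ vs)
      with colour-union (λ v → type v ∈ᵖ? p) (part-colourable p valid) (parts-colourable ps vs)
    ... | c , c< , proper =
      c , (λ v → c< v ∘ Any.toSum) , λ x y x~y qx qy → proper x y x~y (Any.toSum qx) (Any.toSum qy)

    certified-colourable : ∀ {ps} → Certificate Fs H ps → Colourable G 7
    certified-colourable {ps} (≤7 , valid , covered) with parts-colourable ps valid
    ... | c , c< , proper =
      (λ v → Fin.fromℕ< (c<7 v)) ,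
      λ x y x~y eq → proper x y x~y (cover x) (cover y) (Fin.fromℕ<-injective _ _ (c<7 x) (c<7 y) eq)
      where
      cover : ∀ v → Any (type v ∈ᵖ_) ps
      cover v with covered (type v) | seed? v
      ... | inj₁ q            | _              = q
      ... | inj₂ (_ , no-row) | yes (i , refl) = contradiction (sym (type-seed i)) (no-row i)
      ... | inj₂ (e , _)      | no v∉          =
        contradiction (attached v∉ ∷ o) (excluded⇒forbidden fs e _)

      c<7 : ∀ v → c v ℕ.< 7
      c<7 v = ℕ.<-≤-trans (c< v (cover v)) ≤7

-- Embeddings and induced subgraphs

does⇔ : ∀ {A B : Set} (a? : Dec A) (b? : Dec B) → does a? ≡ does b? → A ⇔ B
does⇔ (yes a) (yes b) _ = mk⇔ (λ _ → b) (λ _ → a)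
does⇔ (no ¬a) (no ¬b) _ = mk⇔ (λ a → contradiction a ¬a) (λ b → contradiction b ¬b)

element∈ : ∀ (S : Subset n) j → element S j ∈ S
element∈ (inside  ∷ S) zero    = here
element∈ (inside  ∷ S) (suc j) = there (element∈ S j)
element∈ (outside ∷ S) j       = there (element∈ S j)

index : ∀ {S : Subset n} {x} → x ∈ S → ∃ λ j → element S j ≡ x
index {S = inside  ∷ S} here        = zero , refl
index {S = inside  ∷ S} (there x∈S) = let j , e = index x∈S in suc j , cong suc e
index {S = outside ∷ S} (there x∈S) = let j , e = index x∈S in j , cong suc e

-- The subset is the image of `f`. Its increasing enumeration need not follow `f`, so vertex `i` is
-- matched with the position of `f i` in it.
embedding⇒isInducedIn : ∀ (H : Graph m) (G : Graph n) (f : Fin m → Fin n) →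
  (∀ {i j} → f i ≡ f j → i ≡ j) →
  (∀ i j → Graph._~_ H i j ⇔ Graph._~_ G (f i) (f j)) → H isInducedIn G
embedding⇒isInducedIn {m} {n} H G f inj f-adj = S , record
  { vertices = mk↔ₛ′ to from
      (λ j → element-injective S (trans (element-to (from j)) (proj₂ (preimage j))))
      (λ i → inj (trans (proj₂ (preimage (to i))) (element-to i)))
  ; adjacent = λ i j → subst₂ (λ x y → Graph._~_ H i j ⇔ Graph._~_ G x y)
      (sym (element-to i)) (sym (element-to j)) (f-adj i j)
  }
  where
  image? : ∀ x → Dec (∃ λ i → f i ≡ x)
  image? x = Fin.any? λ i → f i Fin.≟ x

  S : Subset n
  S = tabulate λ x → does (image? x)

  f∈S : ∀ i → f i ∈ S
  f∈S i = Vec.lookup⇒[]= (f i) S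
    (trans (Vec.lookup∘tabulate _ (f i)) (dec-true (image? (f i)) (i , refl)))

  to : Fin m → Fin ∣ S ∣
  to i = proj₁ (index (f∈S i))

  element-to : ∀ i → element S (to i) ≡ f i
  element-to i = proj₂ (index (f∈S i))

  preimage : ∀ j → ∃ λ i → f i ≡ element S j
  preimage j = does⇒ (image? _)
    (trans (sym (Vec.lookup∘tabulate _ (element S j))) (Vec.[]=⇒lookup (element∈ S j)))

  from : Fin ∣ S ∣ → Fin m
  from j = proj₁ (preimage j)

Agrees : Pattern k → Graph k → Set
Agrees H H₀ = ∀ i j → edge H i j ≡ does (Graph._~?_ H₀ i j)

agrees? : ∀ (H : Pattern k) H₀ → Dec (Agrees H H₀)
agrees? H H₀ = Fin.all? λ i → Fin.all? λ j → edge H i j Bool.≟ does (Graph._~?_ H₀ i j)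

-- `H` and `H₀` number their vertices alike, so comparing them is a finite check, settled by
-- evaluation through `agrees`.
free⇒forbidden : ∀ (G : Graph n) (H₀ : Graph k) {H : Pattern k} {agrees : True (agrees? H H₀)} →
                 G isFreeOf H₀ → Forbidden G H
free⇒forbidden G H₀ {agrees = agrees} free vs o =
  free (embedding⇒isInducedIn H₀ G (lookup vs) (occurs-injective G o) λ i j →
    does⇔ (Graph._~?_ H₀ i j) (Graph._~?_ G _ _)
      (trans (sym (toWitness agrees i j)) (sym (occurs-edge G o i j))))

-- The excluded patterns and their certificates

certified : ∀ {Fs} {H : Pattern k} {ps} {valid : True (certificate? Fs H ps)} → Certificate Fs H ps
certified {valid = valid} = toWitness valid

types : List ℕ → Part k
types ms = indep (map (bits _) ms)

-- The vertices are added from `v₃` back to `u₁`, to match the numbering of `co-domino` and `co-A`.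
-- Compared with 7, the code 23 has one more bit, for the edge from `u₁` to `v₃`.
coDomino coA : Pattern 6
coDomino = ∅ ▸ 0 ▸ 1 ▸ 3 ▸ 4 ▸ 1 ▸ 7
coA      = ∅ ▸ 0 ▸ 1 ▸ 3 ▸ 4 ▸ 1 ▸ 23

-- These graphs and the partitions in their certificates were found by computer search.
H₁ : Pattern 6
H₁ = ∅ ▸ 0 ▸ 1 ▸ 3 ▸ 0 ▸ 9 ▸ 14

H₂ : Pattern 6
H₂ = ∅ ▸ 0 ▸ 1 ▸ 3 ▸ 0 ▸ 9 ▸ 10

H₃ : Pattern 6
H₃ = ∅ ▸ 0 ▸ 1 ▸ 3 ▸ 0 ▸ 9 ▸ 25

H₄ : Pattern 7
H₄ = ∅ ▸ 0 ▸ 1 ▸ 3 ▸ 0 ▸ 13 ▸ 26 ▸ 47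

H₅ : Pattern 6
H₅ = ∅ ▸ 0 ▸ 1 ▸ 3 ▸ 0 ▸ 13 ▸ 23

-- A diamond with a pendant vertex at a vertex of degree two; `H₄` and `H₅` extend it.
kite : Pattern 5
kite = ∅ ▸ 0 ▸ 1 ▸ 3 ▸ 0 ▸ 13

-- A triangle with a tail of two edges; `H₁`, `H₂` and `H₃` each add one vertex to it.
tadpole : Pattern 5
tadpole = ∅ ▸ 0 ▸ 1 ▸ 3 ▸ 0 ▸ 9

butterfly : Pattern 5
butterfly = ∅ ▸ 0 ▸ 1 ▸ 3 ▸ 4 ▸ 9

K₃ : Pattern 3
K₃ = ∅ ▸ 0 ▸ 1 ▸ 3

K₂ : Pattern 2
K₂ = ∅ ▸ 0 ▸ 1

-- The triangle is 0, 1, 2 and the edge is 3, 4. As `K₃∪K₂` is not yet excluded, `anti₃` is used.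
-- The first independent set is adjacent to both 3 and 4; the other three are grouped by the two
-- triangle vertices they see.
K₃∪K₂-certificate : Certificate
  (K₄ ◂ P₃∪P₂ ◂ coA ◂ coDomino ◂ []) K₃∪K₂
  (anti₃ (# 2) (# 1) ∷
   types (26 ∷ 27 ∷ 28 ∷ 29 ∷ 30 ∷ []) ∷
   types (6 ∷ 14 ∷ 22 ∷ []) ∷
   types (5 ∷ 13 ∷ 21 ∷ []) ∷
   types (3 ∷ 11 ∷ 19 ∷ []) ∷ [])
K₃∪K₂-certificate = certified

H₁-certificate : Certificate
  (K₄ ◂ P₃∪P₂ ◂ coA ◂ coDomino ◂ K₃∪K₂ ◂ []) H₁
  (anti₂ (# 4) (# 3) ∷
   types (26 ∷ 28 ∷ 30 ∷ []) ∷
   types (49 ∷ 51 ∷ 52 ∷ 53 ∷ []) ∷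
   types (41 ∷ 43 ∷ 44 ∷ 45 ∷ []) ∷
   types (18 ∷ 19 ∷ 20 ∷ []) ∷
   types (10 ∷ 11 ∷ 12 ∷ []) ∷ [])
H₁-certificate = certified

H₂-certificate : Certificate
  (K₄ ◂ P₃∪P₂ ◂ coA ◂ K₃∪K₂ ◂ H₁ ◂ []) H₂
  (anti₂ (# 5) (# 4) ∷
   types (18 ∷ 20 ∷ 26 ∷ []) ∷
   types (27 ∷ 30 ∷ []) ∷
   types (33 ∷ 36 ∷ 41 ∷ []) ∷
   types (43 ∷ 45 ∷ []) ∷
   types (48 ∷ 51 ∷ 52 ∷ []) ∷ [])
H₂-certificate = certified

H₃-certificate : Certificate
  (K₄ ◂ H₂ ◂ P₃∪P₂ ◂ coDomino ◂ H₁ ◂ K₃∪K₂ ◂ coA ◂ []) H₃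
  (anti₂ (# 4) (# 3) ∷
   anti₂ (# 5) (# 0) ∷
   types (48 ∷ 50 ∷ 52 ∷ []) ∷
   types (41 ∷ 42 ∷ 44 ∷ 45 ∷ []) ∷
   types (11 ∷ 19 ∷ 27 ∷ 31 ∷ []) ∷ [])
H₃-certificate = certified

-- All seven colours go to independent sets of types.
H₄-certificate : Certificate
  (K₄ ◂ P₃∪P₂ ◂ H₃ ◂ coA ◂ coDomino ◂ []) H₄
  (types (41 ∷ 72 ∷ 97 ∷ 104 ∷ 105 ∷ []) ∷
   types (0 ∷ 2 ∷ 4 ∷ 6 ∷ 22 ∷ 38 ∷ []) ∷
   types (70 ∷ 86 ∷ 90 ∷ 92 ∷ 94 ∷ []) ∷
   types (1 ∷ 3 ∷ 5 ∷ 21 ∷ 33 ∷ 37 ∷ 56 ∷ 64 ∷ []) ∷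
   types (7 ∷ 19 ∷ 23 ∷ 35 ∷ 39 ∷ 55 ∷ []) ∷
   types (30 ∷ 57 ∷ 58 ∷ 60 ∷ 62 ∷ []) ∷
   types (65 ∷ 66 ∷ 68 ∷ 88 ∷ []) ∷ [])
H₄-certificate = certified

H₅-certificate : Certificate
  (K₄ ◂ H₃ ◂ coA ◂ P₃∪P₂ ◂ H₄ ◂ K₃∪K₂ ◂ []) H₅
  (anti₂ (# 4) (# 3) ∷
   types (10 ∷ 14 ∷ 42 ∷ 46 ∷ []) ∷
   types (17 ∷ 21 ∷ 49 ∷ 53 ∷ []) ∷
   types (11 ∷ 19 ∷ 27 ∷ []) ∷
   types (18 ∷ 28 ∷ 30 ∷ 52 ∷ []) ∷
   types (9 ∷ 29 ∷ 44 ∷ []) ∷ [])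
H₅-certificate = certified

kite-certificate : Certificate
  (K₄ ◂ H₅ ◂ P₃∪P₂ ◂ H₃ ◂ coA ◂ K₃∪K₂ ◂ []) kite
  (anti₂ (# 4) (# 3) ∷
   anti₂ (# 1) (# 0) ∷
   types (17 ∷ 18 ∷ 21 ∷ []) ∷
   types (9 ∷ 10 ∷ 13 ∷ []) ∷
   types (14 ∷ 22 ∷ 26 ∷ []) ∷ [])
kite-certificate = certified

-- Three seed edges take two colours each. Among the types that miss none of these edges, only 9 and
-- 13 survive, and they share the seventh colour.
tadpole-certificate : Certificate
  (kite ◂ K₄ ◂ H₂ ◂ coDomino ◂ P₃∪P₂ ◂ K₃∪K₂ ◂ []) tadpole
  (anti₂ (# 4) (# 3) ∷
   anti₂ (# 3) (# 2) ∷
   anti₂ (# 1) (# 0) ∷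
   types (9 ∷ 13 ∷ []) ∷ [])
tadpole-certificate = certified

butterfly-certificate : Certificate
  (kite ◂ K₄ ◂ P₃∪P₂ ◂ K₃∪K₂ ◂ []) butterfly
  (anti₂ (# 3) (# 2) ∷
   types (15 ∷ []) ∷
   types (10 ∷ 24 ∷ 26 ∷ []) ∷
   types (6 ∷ 20 ∷ 22 ∷ []) ∷
   types (9 ∷ 25 ∷ []) ∷
   types (5 ∷ 21 ∷ []) ∷ [])
butterfly-certificate = certified

-- An edge within a type seeing one triangle vertex gives a `butterfly`, and within a type seeing
-- two it gives a `K₄`.
K₃-certificate : Certificate
  (K₄ ◂ butterfly ◂ P₃∪P₂ ◂ K₃∪K₂ ◂ []) K₃
  (anti₂ (# 2) (# 1) ∷
   types (4 ∷ []) ∷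
   types (2 ∷ []) ∷
   types (6 ∷ []) ∷
   types (5 ∷ []) ∷
   types (3 ∷ []) ∷ [])
K₃-certificate = certified

K₂-certificate : Certificate
  (K₃ ◂ P₃∪P₂ ◂ K₃∪K₂ ◂ []) K₂
  (anti₂ (# 1) (# 0) ∷
   types (2 ∷ []) ∷
   types (1 ∷ []) ∷ [])
K₂-certificate = certified

-- With an empty seed there is a single type, and a graph without edges needs one colour.
null-certificate : Certificate
  (K₂ ◂ []) ∅
  (types (0 ∷ []) ∷ [])
null-certificate = certified

theorem1p3 : ∀ (n : ℕ) (G : Graph n) →
    G isFreeOf (P 3 ∪ᴳ P 2) →
    G isFreeOf K 4 →
    G isFreeOf co-domino →
    G isFreeOf co-A →
    ¬ (G [ D₂ G ] isInducedIn K 3) →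
    χ G ≤ 7
theorem1p3 n G P₃∪P₂-isFree K₄-isFree co-domino-isFree co-A-isFree _ =
  -- The bound is decidable, so it may be assumed to fail; each certificate then makes its pattern
  -- forbidden.
  decidable-stable (χ G ℕ.≤? 7) λ χ≰7 → refutation (χ≰7 ∘ χ-minimal G)
  where
  P₃∪P₂-free : Forbidden G P₃∪P₂
  P₃∪P₂-free = free⇒forbidden G (P 3 ∪ᴳ P 2) P₃∪P₂-isFree

  K₄-free : Forbidden G K₄
  K₄-free = free⇒forbidden G (K 4) K₄-isFree

  coDomino-free : Forbidden G coDomino
  coDomino-free = free⇒forbidden G co-domino co-domino-isFree

  coA-free : Forbidden G coA
  coA-free = free⇒forbidden G co-A co-A-isFree

  refutation : ¬ ¬ Colourable G 7
  -- The null pattern occurs in every graph, on the empty seed.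
  refutation uncolourable = null-free [] []
    where
    refute : ∀ {k Fs} {H : Pattern k} {ps} →
             Certificate Fs H ps → AllForbidden G Fs → Forbidden G H
    refute certificate free vs o = uncolourable (certified-colourable G free o certificate)

    K₃∪K₂-free : Forbidden G K₃∪K₂
    K₃∪K₂-free = refute K₃∪K₂-certificate
      (K₄-free ∷ P₃∪P₂-free ∷ coA-free ∷ coDomino-free ∷ [])

    H₁-free : Forbidden G H₁
    H₁-free = refute H₁-certificate
      (K₄-free ∷ P₃∪P₂-free ∷ coA-free ∷ coDomino-free ∷ K₃∪K₂-free ∷ [])

    H₂-free : Forbidden G H₂
    H₂-free = refute H₂-certificate
      (K₄-free ∷ P₃∪P₂-free ∷ coA-free ∷ K₃∪K₂-free ∷ H₁-free ∷ [])

    H₃-free : Forbidden G H₃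
    H₃-free = refute H₃-certificate
      (K₄-free ∷ H₂-free ∷ P₃∪P₂-free ∷ coDomino-free ∷ H₁-free ∷ K₃∪K₂-free ∷
       coA-free ∷ [])

    H₄-free : Forbidden G H₄
    H₄-free = refute H₄-certificate
      (K₄-free ∷ P₃∪P₂-free ∷ H₃-free ∷ coA-free ∷ coDomino-free ∷ [])

    H₅-free : Forbidden G H₅
    H₅-free = refute H₅-certificate
      (K₄-free ∷ H₃-free ∷ coA-free ∷ P₃∪P₂-free ∷ H₄-free ∷ K₃∪K₂-free ∷ [])

    kite-free : Forbidden G kite
    kite-free = refute kite-certificate
      (K₄-free ∷ H₅-free ∷ P₃∪P₂-free ∷ H₃-free ∷ coA-free ∷ K₃∪K₂-free ∷ [])

    tadpole-free : Forbidden G tadpole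
    tadpole-free = refute tadpole-certificate
      (kite-free ∷ K₄-free ∷ H₂-free ∷ coDomino-free ∷ P₃∪P₂-free ∷ K₃∪K₂-free ∷ [])

    butterfly-free : Forbidden G butterfly
    butterfly-free = refute butterfly-certificate
      (kite-free ∷ K₄-free ∷ P₃∪P₂-free ∷ K₃∪K₂-free ∷ [])

    K₃-free : Forbidden G K₃
    K₃-free = refute K₃-certificate
      (K₄-free ∷ butterfly-free ∷ P₃∪P₂-free ∷ K₃∪K₂-free ∷ [])

    K₂-free : Forbidden G K₂
    K₂-free = refute K₂-certificate (K₃-free ∷ P₃∪P₂-free ∷ K₃∪K₂-free ∷ [])

    null-free : Forbidden G ∅
    null-free = refute null-certificate (K₂-free ∷ [])
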